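{- For every integer $n\ge1$, let $G_n=H_1\vee H_2\vee\cdots\vee H_n$ be a simple complete multipartite graph where each $H_i$ is an independent set with $s_i>(n-1)^2$ vertices. Then for every prime power $q$, $\operatorname{mr}(\mathbb{F}_q,G_n)\le 3$ if and only if $q\ge n-1$.
   Context: $\vee$ denotes the join: the disjoint union together with all edges between vertices of different constituents. For a field $F$ and a simple graph $G$ on vertices $\{1,\dots,n\}$, $S(F,G)$ is the set of symmetric $n\times n$ matrices $A$ over $F$ with $a_{ij}\neq 0$ for $i\ne j$ iff $ij$ is an edge of $G$ (diagonal entries unrestricted), and $\operatorname{mr}(F,G)=\min\{\operatorname{rank}A: A\in S(F,G)\}$. -}

module Defs where

open import Algebra.Bundles using (CommutativeRing)
import Algebra.Properties.Ring as RingProperties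
import Algebra.Properties.Monoid.Sum as MonoidSum
import Algebra.Properties.CommutativeMonoid.Sum as CommutativeMonoidSum
open import Data.Empty using (⊥)
open import Data.Fin.Base using (Fin; zero; suc)
open import Data.Fin.Properties using (_≟_; any?; all?; +↔⊎; pigeonhole; <⇒≢)
open import Data.Nat.Base as ℕ using (ℕ; zero; suc; _^_; _≤_; z≤n; s≤s)
open import Data.Nat.Primality using (Prime)
open import Data.Nat.Properties using (≤-antisym; ≤-pred; ≤∧≢⇒<; ≮⇒≥) renaming (_≟_ to _≟ℕ_)
open import Data.Product.Base using (Σ; ∃; ∃₂; ∃-syntax; _×_; _,_; proj₁; proj₂)
open import Data.Sum.Base using (_⊎_; inj₁; inj₂)
open import Data.Vec.Functional using (foldr; head; tail; _∷_)
open import Function.Base using (_∘_)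
open import Function.Bundles using (Inverse; _↔_; _⇔_; mk⇔; mk↔ₛ′; Equivalence)
open import Function.Properties.Inverse using (Inverse⇒Injection)
open import Level using (Level; 0ℓ; _⊔_; Setω) renaming (suc to lsuc)
open import Relation.Binary.Core using (Rel)
open import Relation.Binary.Definitions using (Symmetric; Irreflexive; Reflexive; Decidable)
open import Relation.Binary.PropositionalEquality
  using (_≡_; _≢_; refl; cong; subst)
import Relation.Binary.PropositionalEquality as ≡
open import Relation.Nullary
  using (Dec; yes; no; ¬_; ¬?; _×-dec_; _→-dec_; contradiction)
open import Relation.Nullary.Decidable using (map′; decidable-stable; via-injection)
import Relation.Unary as U

private
  variable
    a b c ℓ p : Level
    n q : ℕ

-- The library's HeytingField carries an apartness relation; here, as in the
-- classical definition, x is nonzero when ¬ (x ≈ 0#).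
record Field (c ℓ : Level) : Set (lsuc (c ⊔ ℓ)) where
  field
    commutativeRing : CommutativeRing c ℓ
  open CommutativeRing commutativeRing public
  field
    1≉0     : ¬ (1# ≈ 0#)
    inverse : ∀ x → ¬ (x ≈ 0#) → ∃[ y ] x * y ≈ 1#

-- 𝔽_q, i.e. any field with exactly q elements (up to the field's own
-- equality _≈_); such a field is unique up to isomorphism.
record FiniteField (c ℓ : Level) (q : ℕ) : Set (lsuc (c ⊔ ℓ)) where
  field
    baseField : Field c ℓ
    elements  : Inverse (Field.setoid baseField) (≡.setoid (Fin q))

IsPrimePower : ℕ → Set
IsPrimePower q = ∃₂ λ p k → Prime p × 1 ≤ k × q ≡ p ^ k

-- The vertex set is any type with an enumeration by Fin order, so that a join
-- can literally have the disjoint union of the vertex sets as its vertices.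
record SimpleGraph : Set₁ where
  infix 4 _~_ _~?_
  field
    Vertex   : Set
    order    : ℕ
    vertices : Fin order ↔ Vertex
    _~_      : Rel Vertex 0ℓ
    _~?_     : Decidable _~_
    ~-sym    : Symmetric _~_
    ~-irrefl : Irreflexive _≡_ _~_

open SimpleGraph using (Vertex; order; vertices)

independentSet : ℕ → SimpleGraph
independentSet n = record
  { Vertex   = Fin n
  ; order    = n
  ; vertices = mk↔ₛ′ (λ i → i) (λ i → i) (λ _ → refl) (λ _ → refl)
  ; _~_      = λ _ _ → ⊥
  ; _~?_     = λ _ _ → no (λ ())
  ; ~-sym    = λ ()
  ; ~-irrefl = λ _ ()
  }

data JoinEdge (H : Fin n → SimpleGraph) : Rel (Σ (Fin n) (Vertex ∘ H)) 0ℓ where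
  within : ∀ {i u v} → SimpleGraph._~_ (H i) u v → JoinEdge H (i , u) (i , v)
  across : ∀ {i j u v} → i ≢ j → JoinEdge H (i , u) (j , v)

enumerateΣ : ∀ {B : Fin n → Set} (s : Fin n → ℕ) → (∀ i → Fin (s i) ↔ B i) →
             Fin (foldr ℕ._+_ 0 s) ↔ Σ (Fin n) B
enumerateΣ {zero}          s e = mk↔ₛ′ (λ ()) (λ ()) (λ ()) (λ ())
enumerateΣ {suc n} {B = B} s e = mk↔ₛ′ to from to∘from from∘to
  where
  module S = Inverse (+↔⊎ {s zero} {foldr ℕ._+_ 0 (tail s)})
  module E = Inverse (e zero)
  module R = Inverse (enumerateΣ {B = B ∘ suc} (tail s) (e ∘ suc))

  to′ : Fin (s zero) ⊎ Fin (foldr ℕ._+_ 0 (tail s)) → Σ (Fin (suc n)) B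
  to′ (inj₁ x) = zero , E.to x
  to′ (inj₂ y) = suc (proj₁ (R.to y)) , proj₂ (R.to y)

  from′ : Σ (Fin (suc n)) B → Fin (s zero) ⊎ Fin (foldr ℕ._+_ 0 (tail s))
  from′ (zero  , u) = inj₁ (E.from u)
  from′ (suc i , u) = inj₂ (R.from (i , u))

  to   = to′ ∘ S.to
  from = S.from ∘ from′

  to′∘from′ : ∀ w → to′ (from′ w) ≡ w
  to′∘from′ (zero  , u) = cong (zero ,_) (E.strictlyInverseˡ u)
  to′∘from′ (suc i , u) =
    cong (λ w → suc (proj₁ w) , proj₂ w) (R.strictlyInverseˡ (i , u))

  from′∘to′ : ∀ z → from′ (to′ z) ≡ z
  from′∘to′ (inj₁ x) = cong inj₁ (E.strictlyInverseʳ x)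
  from′∘to′ (inj₂ y) = cong inj₂ (R.strictlyInverseʳ y)

  to∘from : ∀ w → to (from w) ≡ w
  to∘from w = ≡.trans (cong to′ (S.strictlyInverseˡ (from′ w))) (to′∘from′ w)

  from∘to : ∀ x → from (to x) ≡ x
  from∘to x = ≡.trans (cong S.from (from′∘to′ (S.to x))) (S.strictlyInverseʳ x)

⋁ : (Fin n → SimpleGraph) → SimpleGraph
⋁ {n} H = record
  { Vertex   = Σ (Fin n) (Vertex ∘ H)
  ; order    = foldr ℕ._+_ 0 (order ∘ H)
  ; vertices = enumerateΣ (order ∘ H) (vertices ∘ H)
  ; _~_      = JoinEdge H
  ; _~?_     = edge?
  ; ~-sym    = edge-sym
  ; ~-irrefl = edge-irrefl
  }
  where
  edge? : Decidable (JoinEdge H)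
  edge? (i , u) (j , v) with i ≟ j
  ... | no i≢j   = yes (across i≢j)
  ... | yes refl = map′ within
    (λ { (within e) → e ; (across i≢i) → contradiction refl i≢i })
    (SimpleGraph._~?_ (H i) u v)

  edge-sym : Symmetric (JoinEdge H)
  edge-sym (within {i} e) = within (SimpleGraph.~-sym (H i) e)
  edge-sym (across i≢j)   = across (i≢j ∘ ≡.sym)

  edge-irrefl : Irreflexive _≡_ (JoinEdge H)
  edge-irrefl refl (within {i} e) = SimpleGraph.~-irrefl (H i) refl e
  edge-irrefl refl (across i≢i)   = i≢i refl

completeMultipartite : (Fin n → ℕ) → SimpleGraph
completeMultipartite s = ⋁ (λ i → independentSet (s i))

module _ (F : Field c ℓ) where
  open Field F using (Carrier; _≈_; 0#; _*_; +-monoid)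
  open MonoidSum +-monoid using (sum)

  LinearlyIndependent : ∀ {V : Set} {k} → (Fin k → V → Carrier) → Set (c ⊔ ℓ)
  LinearlyIndependent {V} {k} w =
    (x : Fin k → Carrier) →
    (∀ u → sum (λ i → x i * w i u) ≈ 0#) → ∀ i → x i ≈ 0#

  IndependentColumns : ∀ {V : Set} (A : V → V → Carrier) {k} →
                       (Fin k → V) → Set (c ⊔ ℓ)
  IndependentColumns A col = LinearlyIndependent (λ i u → A u (col i))

  -- r is the rank of A (the dimension of its column space): the largest size
  -- of a linearly independent family of columns.  Injectivity of col need not
  -- be assumed, as a family repeating a column is never independent.
  IsRank : ∀ {V : Set} → (V → V → Carrier) → ℕ → Set (c ⊔ ℓ)
  IsRank {V} A r =
    (∃[ col ] IndependentColumns A {r} col) ×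
    (∀ k (col : Fin k → V) → IndependentColumns A col → k ≤ r)

  module _ (G : SimpleGraph) where
    open SimpleGraph G using (_~_)

    Matrix : Set c
    Matrix = Vertex G → Vertex G → Carrier

    record 𝒮 (A : Matrix) : Set (c ⊔ ℓ) where
      field
        symmetric : ∀ u v → A u v ≈ A v u
        pattern-⇔ : ∀ u v → u ≢ v → (¬ (A u v ≈ 0#)) ⇔ u ~ v

    IsMinRank : ℕ → Set (c ⊔ ℓ)
    IsMinRank m =
      (∃[ A ] 𝒮 A × IsRank A m) ×
      (∀ A r → 𝒮 A → IsRank A r → m ≤ r)

    isMinRank-unique : ∀ {m m′} → IsMinRank m → IsMinRank m′ → m ≡ m′
    isMinRank-unique ((A , A∈𝒮 , rA) , min) ((B , B∈𝒮 , rB) , min′) =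
      ≤-antisym (min B _ B∈𝒮 rB) (min′ A _ A∈𝒮 rA)

least : ∀ {P : ℕ → Set p} → U.Decidable P → ∀ {n} → P n →
        ∃[ m ] P m × (∀ k → P k → m ≤ k)
least P? {n} pn with P? 0
least P? {n}     pn | yes p0 = 0 , p0 , λ _ _ → z≤n
least P? {zero}  pn | no ¬p0 = contradiction pn ¬p0
least P? {suc n} pn | no ¬p0 with least (P? ∘ suc) pn
... | m , pm , min =
  suc m , pm , λ { zero p0 → contradiction p0 ¬p0 ; (suc k) pk → s≤s (min k pk) }

greatest : ∀ {P : ℕ → Set p} → U.Decidable P → P 0 →
           ∀ N → (∀ k → P k → k ≤ N) → ∃[ m ] P m × (∀ k → P k → k ≤ m)
greatest P? p0 zero    bound = 0 , p0 , bound
greatest P? p0 (suc N) bound with P? (suc N)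
... | yes pN = suc N , pN , bound
... | no ¬pN = greatest P? p0 N λ k pk →
  ≤-pred (≤∧≢⇒< (bound k pk) λ { refl → ¬pN pk })

Searchable : {A : Set a} → Rel A ℓ → Setω
Searchable {A = A} _≈_ =
  ∀ {p} (P : U.Pred A p) → (∀ {x y} → x ≈ y → P x → P y) →
  U.Decidable P → Dec (∃ P)

Pointwise : ∀ {A : Set a} {V : Set} → Rel A ℓ → Rel (V → A) ℓ
Pointwise _≈_ f g = ∀ v → f v ≈ g v

module _ {A : Set a} {_≈_ : Rel A ℓ} (≈-refl : Reflexive _≈_) where

  searchVector : Searchable _≈_ → ∀ n → Searchable (Pointwise {V = Fin n} _≈_)
  searchVector search zero    P resp P? =
    map′ (empty ,_) (λ { (f , pf) → resp (λ ()) pf }) (P? empty)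
    where
    empty : Fin 0 → A
    empty ()
  searchVector search (suc n) P resp P? =
    map′ (λ { (x , f , pf) → x ∷ f , pf })
         (λ { (f , pf) → head f , tail f ,
              resp (λ { zero → ≈-refl ; (suc i) → ≈-refl }) pf })
         (search (λ x → ∃[ f ] P (x ∷ f))
            (λ { x≈y (f , pf) → f ,
                 resp (λ { zero → x≈y ; (suc i) → ≈-refl }) pf })
            (λ x → searchVector search n (λ f → P (x ∷ f))
               (λ f≈g → resp (λ { zero → ≈-refl ; (suc i) → f≈g i }))
               (λ f → P? (x ∷ f))))

  searchFunction : ∀ {V : Set} → Fin n ↔ V → Searchable _≈_ →
                   Searchable (Pointwise {V = V} _≈_)
  searchFunction e search P resp P? =
    map′ (λ { (f , pf) → f ∘ E.from , pf })
         (λ { (g , pg) → g ∘ E.to ,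
              resp (λ v → subst (λ w → g v ≈ g w)
                            (≡.sym (E.strictlyInverseˡ v)) ≈-refl) pg })
         (searchVector search _ (λ f → P (f ∘ E.from))
            (λ f≈g → resp (λ v → f≈g (E.from v))) (λ f → P? (f ∘ E.from)))
    where module E = Inverse e

searchEnumerated : ∀ {V : Set} → Fin n ↔ V → Searchable (_≡_ {A = V})
searchEnumerated e P _ P? =
  map′ (λ { (i , pi) → E.to i , pi })
       (λ { (v , pv) → E.from v , subst P (≡.sym (E.strictlyInverseˡ v)) pv })
       (any? (P? ∘ E.to))
  where module E = Inverse e

∀-enumerated? : ∀ {V : Set} {P : V → Set p} → Fin n ↔ V → U.Decidable P →
                Dec (∀ v → P v)
∀-enumerated? {P = P} e P? =
  map′ (λ h v → subst P (E.strictlyInverseˡ v) (h (E.from v)))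
       (λ h i → h (E.to i))
       (all? (P? ∘ E.to))
  where module E = Inverse e

module _ (F : Field c ℓ) where
  open Field F hiding (refl; zero)
  open Field F using () renaming (refl to ≈-refl)
  open RingProperties ring
    using (-0#≈0#; -‿distribˡ-*; -‿+-comm)
  open MonoidSum +-monoid using (sum; sum-cong-≋; sum-replicate-zero)
  open CommutativeMonoidSum +-commutativeMonoid using (∑-distrib-+)
  open import Relation.Binary.Reasoning.Setoid setoid

  private
    δ : ∀ {k} → Fin k → Fin k → Carrier
    δ zero    zero    = 1#
    δ zero    (suc _) = 0#
    δ (suc _) zero    = 0#
    δ (suc i) (suc j) = δ i j

    δ-diag : ∀ {k} (i : Fin k) → δ i i ≡ 1#
    δ-diag zero    = refl
    δ-diag (suc i) = δ-diag i

    δ-off : ∀ {k} (i j : Fin k) → i ≢ j → δ i j ≡ 0#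
    δ-off zero    zero    i≢j = contradiction refl i≢j
    δ-off zero    (suc j) i≢j = refl
    δ-off (suc i) zero    i≢j = refl
    δ-off (suc i) (suc j) i≢j = δ-off i j (i≢j ∘ cong suc)

    sum-δ : ∀ {k} (i : Fin k) (y : Fin k → Carrier) → sum (λ t → δ i t * y t) ≈ y i
    sum-δ {suc k} zero y = begin
      1# * y zero + sum (λ t → 0# * y (suc t))
        ≈⟨ +-cong (*-identityˡ _) (sum-cong-≋ (λ t → zeroˡ (y (suc t)))) ⟩
      y zero + sum {k} (λ _ → 0#) ≈⟨ +-congˡ (sum-replicate-zero k) ⟩
      y zero + 0#                 ≈⟨ +-identityʳ _ ⟩
      y zero                      ∎
    sum-δ (suc i) y = begin
      0# * y zero + sum (λ t → δ i t * y (suc t))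
        ≈⟨ +-cong (zeroˡ _) (sum-δ i (y ∘ suc)) ⟩
      0# + y (suc i) ≈⟨ +-identityˡ _ ⟩
      y (suc i)      ∎

    sum-neg : ∀ {k} (y : Fin k → Carrier) → sum (λ t → - y t) ≈ - sum y
    sum-neg {zero}  y = sym -0#≈0#
    sum-neg {suc k} y = trans (+-congˡ (sum-neg (y ∘ suc))) (-‿+-comm _ _)

  independent⇒distinct : ∀ {V : Set} (A : V → V → Carrier) {k} (col : Fin k → V) →
    IndependentColumns F A col → ∀ i j → i ≢ j → col i ≢ col j
  independent⇒distinct A col ind i j i≢j eq = 1≉0 (begin
    1#            ≈⟨ +-identityʳ 1# ⟨
    1# + 0#       ≈⟨ +-congˡ -0#≈0# ⟨
    1# - 0#       ≡⟨ ≡.cong₂ _-_ (δ-diag i) (δ-off j i (i≢j ∘ ≡.sym)) ⟨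
    δ i i - δ j i ≈⟨ ind (λ t → δ i t - δ j t) vanishes i ⟩
    0#            ∎)
    where
    vanishes : ∀ u → sum (λ t → (δ i t - δ j t) * A u (col t)) ≈ 0#
    vanishes u = begin
      sum (λ t → (δ i t - δ j t) * y t)
        ≈⟨ sum-cong-≋ (λ t → trans (distribʳ (y t) (δ i t) (- δ j t))
                                   (+-congˡ (sym (-‿distribˡ-* (δ j t) (y t))))) ⟩
      sum (λ t → δ i t * y t + - (δ j t * y t))
        ≈⟨ ∑-distrib-+ (λ t → δ i t * y t) (λ t → - (δ j t * y t)) ⟩
      sum (λ t → δ i t * y t) + sum (λ t → - (δ j t * y t))
        ≈⟨ +-cong (sum-δ i y) (trans (sum-neg (λ t → δ j t * y t)) (-‿cong (sum-δ j y))) ⟩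
      y i - y j ≡⟨ cong (λ v → A u v - y j) eq ⟩
      y j - y j ≈⟨ -‿inverseʳ (y j) ⟩
      0#        ∎
      where y = λ t → A u (col t)

module _ {q} (𝔽 : FiniteField c ℓ q) where
  open FiniteField 𝔽 using (elements) renaming (baseField to F)
  open Field F hiding (refl; zero)
  open Field F using () renaming (refl to ≈-refl)
  open MonoidSum +-monoid using (sum; sum-cong-≋)

  private
    module El = Inverse elements

  _≈?_ : Decidable _≈_
  _≈?_ = via-injection (Inverse⇒Injection elements) _≟_

  searchField : Searchable _≈_
  searchField P resp P? =
    map′ (λ { (i , pi) → El.from i , pi })
         (λ { (x , px) → El.to x , resp (sym (El.strictlyInverseʳ x)) px })
         (any? (P? ∘ El.from))

  linearlyIndependent? : ∀ {V : Set} → Fin n ↔ V → ∀ {k} (w : Fin k → V → Carrier) →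
                         Dec (LinearlyIndependent F w)
  linearlyIndependent? e {k} w = map′
    (λ none x h → decidable-stable (zero? x) (λ x≉0 → none (x , h , x≉0)))
    (λ ind (x , h , x≉0) → x≉0 (ind x h))
    (¬? (searchVector ≈-refl searchField k
           (λ x → (∀ u → sum (λ i → x i * w i u) ≈ 0#) × ¬ (∀ i → x i ≈ 0#))
           (λ x≈y (h , x≉0) →
              (λ u → trans (sum-cong-≋ (λ i → *-congʳ (sym (x≈y i)))) (h u)) ,
              (λ y≈0 → x≉0 (λ i → trans (x≈y i) (y≈0 i))))
           (λ x → ∀-enumerated? e (λ u → sum (λ i → x i * w i u) ≈? 0#)
                  ×-dec ¬? (zero? x))))
    where
    zero? : ∀ (x : Fin k → Carrier) → Dec (∀ i → x i ≈ 0#)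
    zero? x = all? (λ i → x i ≈? 0#)

  independentColumns-resp : ∀ {V : Set} {A B : V → V → Carrier} {k} {col col′ : Fin k → V} →
    (∀ u v → A u v ≈ B u v) → (∀ i → col i ≡ col′ i) →
    IndependentColumns F A col → IndependentColumns F B col′
  independentColumns-resp {A = A} {B} A≈B col≡ ind x h =
    ind x λ u → trans
      (sum-cong-≋ λ i → *-congˡ
         (trans (A≈B u _) (reflexive (cong (B u) (col≡ i)))))
      (h u)

  isRank-resp : ∀ {V : Set} {A B : V → V → Carrier} {r} → (∀ u v → A u v ≈ B u v) →
                IsRank F A r → IsRank F B r
  isRank-resp A≈B ((col , ind) , max) =
    (col , independentColumns-resp A≈B (λ _ → refl) ind) ,
    (λ k col′ ind′ →
       max k col′ (independentColumns-resp (λ u v → sym (A≈B u v)) (λ _ → refl) ind′))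

  independent⇒bounded : ∀ {V : Set} → Fin n ↔ V → (A : V → V → Carrier) →
    ∀ {k} (col : Fin k → V) → IndependentColumns F A col → k ≤ n
  independent⇒bounded e A col ind = ≮⇒≥ λ n<k →
    let i , j , i<j , eq = pigeonhole n<k (E.from ∘ col)
    in independent⇒distinct F A col ind i j (<⇒≢ i<j)
         (≡.trans (≡.sym (E.strictlyInverseˡ (col i)))
            (≡.trans (cong E.to eq) (E.strictlyInverseˡ (col j))))
    where module E = Inverse e

  rank-exists : ∀ {V : Set} → Fin n ↔ V → (A : V → V → Carrier) → ∃[ r ] IsRank F A r
  rank-exists {n = n} {V} e A
    with r , (col , ind) , max ← greatest
      {P = λ k → ∃[ col ] IndependentColumns F A {k} col}
      (λ k → searchVector refl (searchEnumerated e) k (IndependentColumns F A)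
               (independentColumns-resp {A = A} (λ _ _ → ≈-refl))
               (λ col → linearlyIndependent? e (λ i u → A u (col i))))
      ((λ ()) , λ _ _ ())
      n (λ k (col , ind) → independent⇒bounded e A col ind)
    = r , (col , ind) , λ k col′ ind′ → max k (col′ , ind′)

  isRank-unique : ∀ {V : Set} {A : V → V → Carrier} {r r′} →
                  IsRank F A r → IsRank F A r′ → r ≡ r′
  isRank-unique ((col , ind) , max) ((col′ , ind′) , max′) =
    ≤-antisym (max′ _ col ind) (max _ col′ ind′)

  isRank? : ∀ {V : Set} → Fin n ↔ V → (A : V → V → Carrier) → ∀ r → Dec (IsRank F A r)
  isRank? e A r with r′ , h ← rank-exists e A with r ≟ℕ r′
  ... | yes refl = yes h
  ... | no r≢r′  = no λ h′ → r≢r′ (isRank-unique {A = A} h′ h)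

  module _ (G : SimpleGraph) where
    open SimpleGraph G using (_~_; _~?_; ~-sym)

    private
      _≟ᵛ_ : Decidable (_≡_ {A = Vertex G})
      u ≟ᵛ v = map′ (λ eq → ≡.trans (≡.sym (E.strictlyInverseˡ u))
                              (≡.trans (cong E.to eq) (E.strictlyInverseˡ v)))
                    (cong E.from) (E.from u ≟ E.from v)
        where module E = Inverse (vertices G)

    𝒮-resp : ∀ {A B} → (∀ u v → A u v ≈ B u v) → 𝒮 F G A → 𝒮 F G B
    𝒮-resp A≈B A∈𝒮 = record
      { symmetric = λ u v → trans (sym (A≈B u v)) (trans (symmetric u v) (A≈B v u))
      ; pattern-⇔ = λ u v u≢v → let module P = Equivalence (pattern-⇔ u v u≢v) in mk⇔
          (λ B≉0 → P.to λ A≈0 → B≉0 (trans (sym (A≈B u v)) A≈0))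
          (λ u~v B≈0 → P.from u~v (trans (A≈B u v) B≈0))
      }
      where open 𝒮 A∈𝒮

    𝒮? : ∀ A → Dec (𝒮 F G A)
    𝒮? A = map′ (λ (s , p) → record { symmetric = s ; pattern-⇔ = p })
                (λ A∈𝒮 → 𝒮.symmetric A∈𝒮 , 𝒮.pattern-⇔ A∈𝒮)
      (∀ᵛ (λ u → ∀ᵛ (λ v → A u v ≈? A v u)) ×-dec
       ∀ᵛ (λ u → ∀ᵛ (λ v → ¬? (u ≟ᵛ v) →-dec
         map′ (λ (f , g) → mk⇔ f g) (λ e → Equivalence.to e , Equivalence.from e)
           ((¬? (A u v ≈? 0#) →-dec (u ~? v)) ×-dec
            ((u ~? v) →-dec ¬? (A u v ≈? 0#))))))
      where
      ∀ᵛ : ∀ {p} {P : Vertex G → Set p} → U.Decidable P → Dec (∀ v → P v)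
      ∀ᵛ = ∀-enumerated? (vertices G)

    adjacency : Matrix F G
    adjacency u v with u ~? v
    ... | yes _ = 1#
    ... | no _  = 0#

    adjacency∈𝒮 : 𝒮 F G adjacency
    adjacency∈𝒮 = record { symmetric = symm ; pattern-⇔ = patt }
      where
      symm : ∀ u v → adjacency u v ≈ adjacency v u
      symm u v with u ~? v | v ~? u
      ... | yes _   | yes _   = ≈-refl
      ... | no _    | no _    = ≈-refl
      ... | yes u~v | no v≁u  = contradiction (~-sym u~v) v≁u
      ... | no u≁v  | yes v~u = contradiction (~-sym v~u) u≁v

      patt : ∀ u v → u ≢ v → (¬ (adjacency u v ≈ 0#)) ⇔ u ~ v
      patt u v _ with u ~? v
      ... | yes u~v = mk⇔ (λ _ → u~v) (λ _ → 1≉0)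
      ... | no u≁v  = mk⇔ (λ 0≉0 → contradiction ≈-refl 0≉0) (λ u~v → contradiction u~v u≁v)

    minRank-exists : ∃[ m ] IsMinRank F G m
    minRank-exists
      with m , attained , min ← least
        {P = λ m → ∃[ A ] 𝒮 F G A × IsRank F A m}
        (λ m → searchFunction (λ _ → ≈-refl) (vertices G)
           (searchFunction ≈-refl (vertices G) searchField)
           (λ A → 𝒮 F G A × IsRank F A m)
           (λ A≈B (A∈𝒮 , h) → 𝒮-resp A≈B A∈𝒮 , isRank-resp A≈B h)
           (λ A → 𝒮? A ×-dec isRank? (vertices G) A m))
        (adjacency , adjacency∈𝒮 , proj₂ (rank-exists (vertices G) adjacency))
      = m , attained , λ A r A∈𝒮 h → min r (A , A∈𝒮 , h)

    -- The search is irrelevant to the value: by isMinRank-unique, mr is the only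
    -- number satisfying IsMinRank.
    mr : ℕ
    mr = proj₁ minRank-exists

    mr-isMinRank : IsMinRank F G mr
    mr-isMinRank = proj₂ minRank-exists

{-# OPTIONS --safe #-}

-- Over 𝔽_q a matrix of rank at most 3 restricts to each class Hᵢ as a diagonal
-- matrix, so a class with four vertices contains one whose diagonal entry is 0.
-- One such vertex per class gives a symmetric n × n matrix B of rank at most 3
-- that is zero exactly on the diagonal, i.e. n pairwise non-orthogonal isotropic
-- vectors; scale them so that the row of vertex 0 is 1.  If n - 1 > q, then two
-- columns i ≠ j agree in B₁ᵢ - B₂ᵢ (or in B₁ᵢ, in characteristic 2), and columns
-- 0, 1, 2, i, j (or 0, 1, i, j) span more than three dimensions.  Conversely, for
-- n ≤ q + 1, the points (1, t, t²) of a conic and its point at infinity give B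
-- with entries (tᵢ - tⱼ)² and 1.

module Submission where

open import Defs
open import Data.Fin.Base using (Fin; zero; suc; combine; inject≤; funToFin; finToFun; punchIn)
open import Data.Fin.Patterns using (0F; 1F; 2F; 3F)
open import Data.Fin.Properties
  using (_≟_; any?; pigeonhole; <⇒≢; inject≤-injective; suc-injective;
         finToFun-funToFin; funToFin-finToFin; punchInᵢ≢i)
open import Data.Nat.Base using (ℕ; zero; suc; _∸_; _^_; _≤_; _≥_; _<_; z≤n; s≤s)
open import Data.Nat.Properties
  using (≮⇒≥; ≤-trans; <⇒≤; ^-monoˡ-≤; ^-monoʳ-<)
open import Axiom.UniquenessOfIdentityProofs using (module Decidable⇒UIP)
open import Data.Empty using (⊥)
open import Data.Product.Base using (∃-syntax; ∃₂; _×_; _,_; proj₁; proj₂)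
open import Data.Product.Properties using (,-injectiveʳ-UIP)
open import Data.Vec.Functional using ([]; _∷_)
open import Function.Base using (_∘_)
open import Function.Bundles using (_⇔_; mk⇔; Inverse; Equivalence)
open import Relation.Binary.PropositionalEquality using (_≡_; _≢_; refl; cong; cong₂)
import Relation.Binary.PropositionalEquality as ≡
open import Relation.Nullary using (¬_; yes; no; contradiction)
import Algebra.Properties.AbelianGroup as AbelianGroupProperties
import Algebra.Properties.Ring as RingProperties
import Algebra.Properties.Semiring.Sum as SemiringSum
import Algebra.Solver.Ring.NaturalCoefficients.Default as NaturalCoefficients

funToFin-cong : ∀ {m n} {f g : Fin m → Fin n} → (∀ i → f i ≡ g i) → funToFin f ≡ funToFin g
funToFin-cong {zero}  f≗g = refl
funToFin-cong {suc m} f≗g = cong₂ combine (f≗g zero) (funToFin-cong (f≗g ∘ suc))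

distinct⇒1< : ∀ {q} {i j : Fin q} → i ≢ j → 1 < q
distinct⇒1< {suc zero} {zero} {zero} i≢j = contradiction refl i≢j
distinct⇒1< {suc (suc q)} _ = s≤s (s≤s z≤n)

-- Arithmetic and finite sums in a field

module FieldProperties {c ℓ} (F : Field c ℓ) where
  open Field F hiding (zero) renaming (refl to ≈-refl)
  open RingProperties ring public
    using (-‿distribˡ-*; -‿distribʳ-*; -‿involutive; +-cancelˡ; +-cancelʳ)
  open AbelianGroupProperties +-abelianGroup public
    using () renaming (identityˡ-unique to x+y≈y⇒x≈0; x∙y⁻¹≈ε⇒x≈y to x-y≈0⇒x≈y)
  open SemiringSum semiring public
    using (sum; sum-cong-≋; sum-replicate-zero; sum-remove; ∑-comm; ∑-distrib-+;
           *-distribˡ-sum)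
  open NaturalCoefficients commutativeSemiring public
    using (solve; _:+_; _:*_; _:=_; con)
  open import Relation.Binary.Reasoning.Setoid setoid

  -- The form in which linear systems are solved below: `z` and `w` are combinations of equations
  -- already known, so the third hypothesis becomes an identity without subtraction, within reach of
  -- the semiring solver.
  x+0≈y+0⇒x≈y : ∀ {x y z w} → z ≈ 0# → w ≈ 0# → x + z ≈ y + w → x ≈ y
  x+0≈y+0⇒x≈y {x} {y} {z} {w} z≈0 w≈0 eq = begin
    x      ≈⟨ +-identityʳ x ⟨
    x + 0# ≈⟨ +-congˡ z≈0 ⟨
    x + z  ≈⟨ eq ⟩
    y + w  ≈⟨ +-congˡ w≈0 ⟩
    y + 0# ≈⟨ +-identityʳ y ⟩
    y      ∎

  0+0≈0 : ∀ {x y} → x ≈ 0# → y ≈ 0# → x + y ≈ 0#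
  0+0≈0 x≈0 y≈0 = trans (+-cong x≈0 y≈0) (+-identityˡ 0#)

  *-zeroʳ : ∀ x {y} → y ≈ 0# → x * y ≈ 0#
  *-zeroʳ x y≈0 = trans (*-congˡ y≈0) (zeroʳ x)

  *-oneʳ : ∀ x {y} → y ≈ 1# → x * y ≈ x
  *-oneʳ x y≈1 = trans (*-congˡ y≈1) (*-identityʳ x)

  *-zeroˡ⁻¹ : ∀ {x y} → ¬ (x ≈ 0#) → x * y ≈ 0# → y ≈ 0#
  *-zeroˡ⁻¹ {x} {y} x≉0 xy≈0 with z , xz≈1 ← inverse x x≉0 = begin
    y           ≈⟨ *-identityˡ y ⟨
    1# * y      ≈⟨ *-congʳ xz≈1 ⟨
    x * z * y   ≈⟨ *-congʳ (*-comm x z) ⟩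
    z * x * y   ≈⟨ *-assoc z x y ⟩
    z * (x * y) ≈⟨ *-zeroʳ z xy≈0 ⟩
    0#          ∎

  *-zeroʳ⁻¹ : ∀ {x y} → ¬ (y ≈ 0#) → x * y ≈ 0# → x ≈ 0#
  *-zeroʳ⁻¹ y≉0 xy≈0 = *-zeroˡ⁻¹ y≉0 (trans (*-comm _ _) xy≈0)

  *-cancelˡ-≉0 : ∀ {x y z} → ¬ (x ≈ 0#) → x * y ≈ x * z → y ≈ z
  *-cancelˡ-≉0 {x} {y} {z} x≉0 xy≈xz = x-y≈0⇒x≈y y z (*-zeroˡ⁻¹ x≉0
    (x+y≈y⇒x≈0 _ (x * z) (begin
      x * (y - z) + x * z ≈⟨ distribˡ x _ _ ⟨
      x * (y - z + z)     ≈⟨ *-congˡ (+-assoc y (- z) z) ⟩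
      x * (y + (- z + z)) ≈⟨ *-congˡ (+-congˡ (-‿inverseˡ z)) ⟩
      x * (y + 0#)        ≈⟨ *-congˡ (+-identityʳ y) ⟩
      x * y               ≈⟨ xy≈xz ⟩
      x * z               ∎)))

  unit⇒≉0 : ∀ {x y} → x * y ≈ 1# → ¬ (x ≈ 0#)
  unit⇒≉0 xy≈1 x≈0 = 1≉0 (trans (sym xy≈1) (trans (*-congʳ x≈0) (zeroˡ _)))

  x+x≈[1+1]x : ∀ x → x + x ≈ (1# + 1#) * x
  x+x≈[1+1]x x = sym (trans (distribʳ x 1# 1#) (+-cong (*-identityˡ x) (*-identityˡ x)))

  -x*-x≈x*x : ∀ x → - x * - x ≈ x * x
  -x*-x≈x*x x = begin
    - x * - x     ≈⟨ -‿distribˡ-* x (- x) ⟨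
    - (x * - x)   ≈⟨ -‿cong (-‿distribʳ-* x x) ⟨
    - - (x * x)   ≈⟨ -‿involutive (x * x) ⟩
    x * x         ∎

  sum-single : ∀ {k} (f : Fin k → Carrier) i → (∀ j → j ≢ i → f j ≈ 0#) → sum f ≈ f i
  sum-single {suc k} f i f≈0 = begin
    sum f                             ≈⟨ sum-remove {i = i} f ⟩
    f i + sum (λ j → f (punchIn i j))
      ≈⟨ +-congˡ (sum-cong-≋ (λ j → f≈0 (punchIn i j) (punchInᵢ≢i i j))) ⟩
    f i + sum {k} (λ _ → 0#)          ≈⟨ +-congˡ (sum-replicate-zero k) ⟩
    f i + 0#                          ≈⟨ +-identityʳ (f i) ⟩
    f i                               ∎

  -- The hypothesis contains the unfolded `sum` over `Fin 4`, with its final `0#`. This turns one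
  -- row of a vanishing combination of four columns into an equation with simplified entries.
  sum₄-cong : ∀ {a b c d a′ b′ c′ d′} → a ≈ a′ → b ≈ b′ → c ≈ c′ → d ≈ d′ →
              a + (b + (c + (d + 0#))) ≈ 0# → a′ + (b′ + (c′ + d′)) ≈ 0#
  sum₄-cong a≈ b≈ c≈ d≈ eq = trans
    (sym (+-cong a≈ (+-cong b≈ (+-cong c≈ (trans (+-identityʳ _) d≈))))) eq

  -- In row `col i` of a vanishing combination only the term of column `col i` survives.
  independent-diagonal : ∀ {V : Set} (A : V → V → Carrier) {k} (col : Fin k → V) →
    (∀ i → ¬ (A (col i) (col i) ≈ 0#)) → (∀ i j → i ≢ j → A (col i) (col j) ≈ 0#) →
    IndependentColumns F A col
  independent-diagonal A col diag off x h i = *-zeroʳ⁻¹ (diag i) (trans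
    (sym (sum-single (λ j → x j * A (col i) (col j)) i
       (λ j j≢i → *-zeroʳ (x j) (off i j (j≢i ∘ ≡.sym)))))
    (h (col i)))

  -- The scaled matrix is D A[u] D, for D diagonal with inverse E.
  independent-scaled : ∀ {V : Set} (A : V → V → Carrier) {n} (u : Fin n → V)
    (d e : Fin n → Carrier) → (∀ i → d i * e i ≈ 1#) → ∀ {k} (col : Fin k → Fin n) →
    IndependentColumns F (λ i j → d i * (d j * A (u i) (u j))) col →
    IndependentColumns F A (u ∘ col)
  independent-scaled A u d e de≈1 col ind x h k =
    *-zeroʳ⁻¹ (unit⇒≉0 (trans (*-comm _ _) (de≈1 (col k))))
      (ind (λ l → x l * e (col l)) vanishes k)
    where
    term : ∀ i l → x l * e (col l) * (d i * (d (col l) * A (u i) (u (col l))))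
                   ≈ d i * (x l * A (u i) (u (col l)))
    term i l = begin
      x l * e j * (d i * (d j * a))
        ≈⟨ solve 5 (λ x e i d a → x :* e :* (i :* (d :* a)) := (d :* e) :* (i :* (x :* a)))
             ≈-refl (x l) (e j) (d i) (d j) a ⟩
      (d j * e j) * (d i * (x l * a)) ≈⟨ *-congʳ (de≈1 j) ⟩
      1# * (d i * (x l * a))          ≈⟨ *-identityˡ _ ⟩
      d i * (x l * a)                 ∎
      where
      j = col l
      a = A (u i) (u j)

    vanishes : ∀ i → sum (λ l → x l * e (col l) * (d i * (d (col l) * A (u i) (u (col l)))))
                     ≈ 0#
    vanishes i = begin
      _ ≈⟨ sum-cong-≋ (term i) ⟩
      sum (λ l → d i * (x l * A (u i) (u (col l))))
        ≈⟨ *-distribˡ-sum (d i) (λ l → x l * A (u i) (u (col l))) ⟨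
      d i * sum (λ l → x l * A (u i) (u (col l))) ≈⟨ *-zeroʳ (d i) (h (u i)) ⟩
      0# ∎

-- Counting over a finite field and bounds on rank

module FiniteFieldProperties {c ℓ q} (𝔽 : FiniteField c ℓ q) where
  open FiniteField 𝔽 using (elements) renaming (baseField to F) public
  open Field F hiding (zero) renaming (refl to ≈-refl)
  open FieldProperties F
  open import Relation.Binary.Reasoning.Setoid setoid
  module El = Inverse elements

  to-injective : ∀ {x y} → El.to x ≡ El.to y → x ≈ y
  to-injective {x} {y} eq = trans (sym (El.strictlyInverseʳ x))
    (trans (El.from-cong eq) (El.strictlyInverseʳ y))

  from-injective : ∀ {i j} → El.from i ≈ El.from j → i ≡ j
  from-injective {i} {j} eq = ≡.trans (≡.sym (El.strictlyInverseˡ i))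
    (≡.trans (El.to-cong eq) (El.strictlyInverseˡ j))

  1<q : 1 < q
  1<q = distinct⇒1< (1≉0 ∘ to-injective)

  collision : ∀ {m} → q < m → (f : Fin m → Carrier) → ∃₂ λ i j → i ≢ j × f i ≈ f j
  collision q<m f with i , j , i<j , eq ← pigeonhole q<m (El.to ∘ f) =
    i , j , <⇒≢ i<j , to-injective eq

  -- Counting: of the q^k linear combinations of k > r vectors, two coincide.
  independent⇒≤ : ∀ {k r} (w : Fin k → Fin r → Carrier) → LinearlyIndependent F w → k ≤ r
  independent⇒≤ {k} {r} w ind = ≮⇒≥ λ r<k →
    let i , j , i<j , eq = pigeonhole (^-monoʳ-< q 1<q r<k) (funToFin ∘ label)
    in <⇒≢ i<j (same i j eq)
    where
    coefficient : Fin (q ^ k) → Fin k → Carrier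
    coefficient i s = El.from (finToFun i s)

    combination : Fin (q ^ k) → Fin r → Carrier
    combination i l = sum (λ s → coefficient i s * w s l)

    label : Fin (q ^ k) → Fin r → Fin q
    label i l = El.to (combination i l)

    same : ∀ i j → funToFin (label i) ≡ funToFin (label j) → i ≡ j
    same i j eq = ≡.trans (≡.sym (funToFin-finToFin {k} {q} i)) (≡.trans
      -- The difference of the two coefficient tuples gives a vanishing combination, so independence
      -- makes the tuples, and hence their codes `i` and `j`, equal.
      (funToFin-cong (λ s → from-injective (x-y≈0⇒x≈y _ _ (ind difference vanishes s))))
      (funToFin-finToFin {k} {q} j))
      where
      difference : Fin k → Carrier
      difference s = coefficient i s - coefficient j s

      split : ∀ s l → difference s * w s l + coefficient j s * w s l ≈ coefficient i s * w s l
      split s l = begin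
        (a - b) * z + b * z ≈⟨ distribʳ z (a - b) b ⟨
        (a - b + b) * z     ≈⟨ *-congʳ (+-assoc a (- b) b) ⟩
        (a + (- b + b)) * z ≈⟨ *-congʳ (+-congˡ (-‿inverseˡ b)) ⟩
        (a + 0#) * z        ≈⟨ *-congʳ (+-identityʳ a) ⟩
        a * z               ∎
        where
        a = coefficient i s
        b = coefficient j s
        z = w s l

      vanishes : ∀ l → sum (λ s → difference s * w s l) ≈ 0#
      vanishes l = x+y≈y⇒x≈0 _ (combination j l) (begin
        sum (λ s → difference s * w s l) + combination j l
          ≈⟨ ∑-distrib-+ (λ s → difference s * w s l) (λ s → coefficient j s * w s l) ⟨
        sum (λ s → difference s * w s l + coefficient j s * w s l)
          ≈⟨ sum-cong-≋ (λ s → split s l) ⟩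
        combination i l
          ≈⟨ to-injective (≡.trans (≡.sym (finToFun-funToFin (label i) l))
               (≡.trans (cong (λ x → finToFun x l) eq) (finToFun-funToFin (label j) l))) ⟩
        combination j l ∎)

  -- A dependency among the vectors `Q (col i)` is one among the chosen columns of the product of
  -- `P` and the transpose of `Q`. So independence passes to vectors of length `r`, where
  -- `independent⇒≤` applies.
  factorisation⇒rank≤ : ∀ {V : Set} {r} (P Q : V → Fin r → Carrier) {k} (col : Fin k → V) →
    IndependentColumns F (λ u v → sum (λ l → P u l * Q v l)) col → k ≤ r
  factorisation⇒rank≤ {r = r} P Q col ind = independent⇒≤ (Q ∘ col) λ x h → ind x λ u → begin
    sum (λ i → x i * sum (λ l → P u l * Q (col i) l))
      ≈⟨ sum-cong-≋ (λ i → *-distribˡ-sum (x i) (λ l → P u l * Q (col i) l)) ⟩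
    sum (λ i → sum (λ l → x i * (P u l * Q (col i) l)))
      ≈⟨ ∑-comm (λ i l → x i * (P u l * Q (col i) l)) ⟩
    sum (λ l → sum (λ i → x i * (P u l * Q (col i) l)))
      ≈⟨ sum-cong-≋ (λ l → sum-cong-≋ (λ i →
           solve 3 (λ x p q → x :* (p :* q) := p :* (x :* q)) ≈-refl (x i) (P u l) (Q (col i) l))) ⟩
    sum (λ l → sum (λ i → P u l * (x i * Q (col i) l)))
      ≈⟨ sum-cong-≋ (λ l → sym (*-distribˡ-sum (P u l) (λ i → x i * Q (col i) l))) ⟩
    sum (λ l → P u l * sum (λ i → x i * Q (col i) l))
      ≈⟨ sum-cong-≋ (λ l → *-zeroʳ (P u l) (h l)) ⟩
    sum {r} (λ _ → 0#)
      ≈⟨ sum-replicate-zero r ⟩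
    0# ∎

  -- `rank-exists` supplies a rank of `A`; it is the size of an independent family of columns, so
  -- `bound` applies to it.
  minRank≤ : ∀ G {A} {μ r} → IsMinRank F G μ → 𝒮 F G A →
    (∀ k (col : Fin k → SimpleGraph.Vertex G) → IndependentColumns F A col → k ≤ r) → μ ≤ r
  minRank≤ G {A} (_ , min) A∈𝒮 bound
    with ρ , (col , ind) , max ← rank-exists 𝔽 (SimpleGraph.vertices G) A
    = ≤-trans (min A ρ A∈𝒮 ((col , ind) , max)) (bound ρ col ind)

-- Pairwise non-orthogonal isotropic vectors in a space of dimension 3

module IsotropicGram {c ℓ q} (𝔽 : FiniteField c ℓ q) where
  open FiniteField 𝔽 using () renaming (baseField to F)
  open Field F hiding (zero) renaming (refl to ≈-refl)
  open FieldProperties F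
  open FiniteFieldProperties 𝔽 using (collision)

  -- `B` is to be read as the Gram matrix of `m + 3` isotropic vectors, scaled so that row 0 is 1
  -- off the diagonal. `B-dependent` expresses rank at most 3 in the form in which it is
  -- contradicted.
  module _ {m} (B : Fin (suc (suc (suc m))) → Fin (suc (suc (suc m))) → Carrier)
    (B-sym : ∀ i j → B i j ≈ B j i)
    (B-diag : ∀ i → B i i ≈ 0#)
    (B-off : ∀ i j → i ≢ j → ¬ (B i j ≈ 0#))
    (B-one : ∀ i → B zero (suc i) ≈ 1#)
    (B-dependent : (col : Fin 4 → Fin (suc (suc (suc m)))) → ¬ IndependentColumns F B col)
    where

    B-one′ : ∀ i → B (suc i) zero ≈ 1#
    B-one′ i = trans (B-sym (suc i) zero) (B-one i)

    -- In characteristic 2 the submatrix on `0, 1, i′, j′` is alternating, with Pfaffian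
    -- `b + B 1F i′ + B 1F j′`. If the last two terms agree, this is `b`, which is nonzero, and the
    -- four columns are independent. The index `zero` belongs to vertex 1, where row 1 has its only
    -- zero.
    row₁-distinct : 1# + 1# ≈ 0# → ∀ i j → i ≢ j → ¬ (B 1F (suc i) ≈ B 1F (suc j))
    row₁-distinct _ zero    zero    i≢j _  = i≢j refl
    row₁-distinct _ zero    (suc j) _   eq = B-off 1F (suc (suc j)) (λ ()) (trans (sym eq) (B-diag 1F))
    row₁-distinct _ (suc i) zero    _   eq = B-off 1F (suc (suc i)) (λ ()) (trans eq (B-diag 1F))
    row₁-distinct 1+1≈0 (suc i) (suc j) i≢j eq = B-dependent (0F ∷ 1F ∷ i′ ∷ j′ ∷ []) independent
      where
      i′ = suc (suc i)
      j′ = suc (suc j)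
      b = B i′ j′
      λ′ = B 1F i′

      b≉0 : ¬ (b ≈ 0#)
      b≉0 = B-off i′ j′ (i≢j ∘ suc-injective)

      x+x≈0 : ∀ x → x + x ≈ 0#
      x+x≈0 x = trans (x+x≈[1+1]x x) (trans (*-congʳ 1+1≈0) (zeroˡ x))

      independent : IndependentColumns F B (0F ∷ 1F ∷ i′ ∷ j′ ∷ [])
      independent x h = λ { 0F → x₀≈0 ; 1F → x₁≈0 ; 2F → x₂≈0 ; 3F → x₃≈0 }
        where
        x₀ = x 0F
        x₁ = x 1F
        x₂ = x 2F
        x₃ = x 3F

        row₀ : 0# + (x₁ + (x₂ + x₃)) ≈ 0#
        row₀ = sum₄-cong (*-zeroʳ _ (B-diag 0F)) (*-oneʳ _ (B-one _)) (*-oneʳ _ (B-one _))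
                 (*-oneʳ _ (B-one _)) (h 0F)

        row₁ : x₀ + (0# + (x₂ * λ′ + x₃ * λ′)) ≈ 0#
        row₁ = sum₄-cong (*-oneʳ _ (B-one′ _)) (*-zeroʳ _ (B-diag 1F)) ≈-refl
                 (*-congˡ (sym eq)) (h 1F)

        rowᵢ : x₀ + (x₁ * λ′ + (0# + x₃ * b)) ≈ 0#
        rowᵢ = sum₄-cong (*-oneʳ _ (B-one′ _)) (*-congˡ (B-sym _ _)) (*-zeroʳ _ (B-diag i′))
                 ≈-refl (h i′)

        rowⱼ : x₀ + (x₁ * λ′ + (x₂ * b + 0#)) ≈ 0#
        rowⱼ = sum₄-cong (*-oneʳ _ (B-one′ _)) (*-congˡ (trans (B-sym _ _) (sym eq)))
                 (*-congˡ (B-sym _ _)) (*-zeroʳ _ (B-diag j′)) (h j′)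

        -- Row 1 minus `λ′` times row 0.
        x₀≈x₁λ : x₀ ≈ x₁ * λ′
        x₀≈x₁λ = x+0≈y+0⇒x≈y (*-zeroʳ λ′ row₀) row₁
          (solve 5 (λ a b c d l → a :+ l :* (con 0 :+ (b :+ (c :+ d)))
                               := b :* l :+ (a :+ (con 0 :+ (c :* l :+ d :* l))))
             ≈-refl x₀ x₁ x₂ x₃ λ′)

        -- Characteristic 2 enters here. What remains of rows `i′` and `j′` is `x₃ * b` and
        -- `x₂ * b`.
        x₀+x₁λ≈0 : x₀ + x₁ * λ′ ≈ 0#
        x₀+x₁λ≈0 = trans (+-congˡ (sym x₀≈x₁λ)) (x+x≈0 x₀)

        x₃≈0 : x₃ ≈ 0#
        x₃≈0 = *-zeroʳ⁻¹ b≉0 (x+0≈y+0⇒x≈y x₀+x₁λ≈0 rowᵢ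
          (solve 3 (λ a b c → c :+ (a :+ b) := con 0 :+ (a :+ (b :+ (con 0 :+ c))))
             ≈-refl x₀ (x₁ * λ′) (x₃ * b)))

        x₂≈0 : x₂ ≈ 0#
        x₂≈0 = *-zeroʳ⁻¹ b≉0 (x+0≈y+0⇒x≈y x₀+x₁λ≈0 rowⱼ
          (solve 3 (λ a b c → c :+ (a :+ b) := con 0 :+ (a :+ (b :+ (c :+ con 0))))
             ≈-refl x₀ (x₁ * λ′) (x₂ * b)))

        x₁≈0 : x₁ ≈ 0#
        x₁≈0 = x+0≈y+0⇒x≈y (0+0≈0 x₂≈0 x₃≈0) row₀
          (solve 3 (λ a b c → a :+ (b :+ c) := con 0 :+ (con 0 :+ (a :+ (b :+ c))))
             ≈-refl x₁ x₂ x₃)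

        x₀≈0 : x₀ ≈ 0#
        x₀≈0 = trans x₀≈x₁λ (trans (*-congʳ x₁≈0) (zeroˡ λ′))

    module OddCharacteristic (1+1≉0 : ¬ (1# + 1# ≈ 0#)) where
      b = B 1F 2F

      b≉0 : ¬ (b ≈ 0#)
      b≉0 = B-off 1F 2F (λ ())

      x+x≈0⇒x≈0 : ∀ {x} → x + x ≈ 0# → x ≈ 0#
      x+x≈0⇒x≈0 {x} eq = *-zeroˡ⁻¹ 1+1≉0 (trans (sym (x+x≈[1+1]x x)) eq)

      -- `α`, `β`, `γ` are the negated coordinates of column `suc i` with respect to columns 0, 1,
      -- 2.
      Relation : Fin (suc (suc m)) → Carrier → Carrier → Carrier → Set _
      Relation i α β γ =
        ∀ u → α * B u 0F + (β * B u 1F + (γ * B u 2F + B u (suc i))) ≈ 0#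

      relation₀ : ∀ {i α β γ} → Relation i α β γ → 0# + (β + (γ + 1#)) ≈ 0#
      relation₀ R = trans (sym (+-cong (*-zeroʳ _ (B-diag 0F)) (+-cong (*-oneʳ _ (B-one _))
        (+-cong (*-oneʳ _ (B-one _)) (B-one _))))) (R 0F)

      relation₁ : ∀ {i α β γ} → Relation i α β γ → α + (0# + (γ * b + B 1F (suc i))) ≈ 0#
      relation₁ R = trans (sym (+-cong (*-oneʳ _ (B-one′ _))
        (+-congʳ (*-zeroʳ _ (B-diag 1F))))) (R 1F)

      relation₂ : ∀ {i α β γ} → Relation i α β γ → α + (β * b + (0# + B 2F (suc i))) ≈ 0#
      relation₂ R = trans (sym (+-cong (*-oneʳ _ (B-one′ _))
        (+-cong (*-congˡ (B-sym 2F 1F)) (+-congʳ (*-zeroʳ _ (B-diag 2F)))))) (R 2F)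

      relationₛ : ∀ {i α β γ} → Relation i α β γ → ∀ u →
        α + (β * B (suc u) 1F + (γ * B (suc u) 2F + B (suc u) (suc i))) ≈ 0#
      relationₛ R u = trans (sym (+-congʳ (*-oneʳ _ (B-one′ u)))) (R (suc u))

      -- The minor on `0, 1, 2` has determinant `2b`, so in a dependency of the four columns the
      -- last coefficient is nonzero and can be scaled to 1. The double negation comes from
      -- `B-dependent` and is harmless, as the final goal is `⊥`.
      relation : ∀ i → ¬ (∀ α β γ → ¬ Relation i α β γ)
      relation i none = B-dependent col independent
        where
        col : Fin 4 → Fin (suc (suc (suc m)))
        col = 0F ∷ 1F ∷ 2F ∷ suc i ∷ []

        independent : IndependentColumns F B col
        independent x h with _≈?_ 𝔽 (x 3F) 0#
        ... | no x₃≉0 with y , x₃y≈1 ← inverse (x 3F) x₃≉0 =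
          contradiction scaled (none (y * x 0F) (y * x 1F) (y * x 2F))
          where
          scaled : Relation i (y * x 0F) (y * x 1F) (y * x 2F)
          scaled u = x+0≈y+0⇒x≈y ≈-refl (*-zeroʳ y (h u)) (trans
            (+-congʳ (+-congˡ (+-congˡ (+-congˡ (sym (trans (*-congʳ x₃y≈1) (*-identityˡ _)))))))
            (solve 9 (λ y x₀ x₁ x₂ x₃ b₀ b₁ b₂ b₃ →
                y :* x₀ :* b₀ :+ (y :* x₁ :* b₁ :+ (y :* x₂ :* b₂ :+ x₃ :* y :* b₃)) :+ con 0
                := con 0 :+ y :* (x₀ :* b₀ :+ (x₁ :* b₁ :+ (x₂ :* b₂ :+ (x₃ :* b₃ :+ con 0)))))
               ≈-refl y (x 0F) (x 1F) (x 2F) (x 3F) (B u 0F) (B u 1F) (B u 2F) (B u (suc i))))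
        ... | yes x₃≈0 = λ { 0F → x₀≈0 ; 1F → x₁≈0 ; 2F → x₂≈0 ; 3F → x₃≈0 }
          where
          x₀ = x 0F
          x₁ = x 1F
          x₂ = x 2F

          last≈0 : ∀ {y} → x 3F * y ≈ 0#
          last≈0 = trans (*-congʳ x₃≈0) (zeroˡ _)

          row₀ : 0# + (x₁ + (x₂ + 0#)) ≈ 0#
          row₀ = sum₄-cong (*-zeroʳ _ (B-diag 0F)) (*-oneʳ _ (B-one _)) (*-oneʳ _ (B-one _))
                   last≈0 (h 0F)

          row₁ : x₀ + (0# + (x₂ * b + 0#)) ≈ 0#
          row₁ = sum₄-cong (*-oneʳ _ (B-one′ _)) (*-zeroʳ _ (B-diag 1F)) ≈-refl last≈0 (h 1F)

          row₂ : x₀ + (x₁ * b + (0# + 0#)) ≈ 0#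
          row₂ = sum₄-cong (*-oneʳ _ (B-one′ _)) (*-congˡ (B-sym 2F 1F)) (*-zeroʳ _ (B-diag 2F))
                   last≈0 (h 2F)

          x₀≈0 : x₀ ≈ 0#
          -- Rows 1 and 2 add up to `2 x₀ + b (x₁ + x₂)`, and row 0 removes the second summand.
          x₀≈0 = x+x≈0⇒x≈0 (x+0≈y+0⇒x≈y (*-zeroʳ b row₀) (0+0≈0 row₁ row₂)
            (solve 4 (λ x y z b →
                x :+ x :+ b :* (con 0 :+ (y :+ (z :+ con 0)))
                := con 0 :+ ((x :+ (con 0 :+ (z :* b :+ con 0))) :+ (x :+ (y :* b :+ (con 0 :+ con 0)))))
               ≈-refl x₀ x₁ x₂ b))

          x₂≈0 : x₂ ≈ 0#
          x₂≈0 = *-zeroʳ⁻¹ b≉0 (x+0≈y+0⇒x≈y x₀≈0 row₁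
            (solve 2 (λ x z → z :+ x := con 0 :+ (x :+ (con 0 :+ (z :+ con 0)))) ≈-refl x₀ (x₂ * b)))

          x₁≈0 : x₁ ≈ 0#
          x₁≈0 = *-zeroʳ⁻¹ b≉0 (x+0≈y+0⇒x≈y x₀≈0 row₂
            (solve 2 (λ x y → y :+ x := con 0 :+ (x :+ (y :+ (con 0 :+ con 0)))) ≈-refl x₀ (x₁ * b)))

      -- The hypothesis says B₁ᵢ - B₂ᵢ = B₁ⱼ - B₂ⱼ.  It forces β = β′ and γ = γ′, so columns
      -- i and j differ by a multiple of column 0; rows i and j then give B i j = - B i j.
      relations-disagree : ∀ i j → i ≢ j →
        B 1F (suc i) + B 2F (suc j) ≈ B 1F (suc j) + B 2F (suc i) →
        ∀ {α β γ α′ β′ γ′} → Relation i α β γ → ¬ Relation j α′ β′ γ′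
      relations-disagree i j i≢j eq {α} {β} {γ} {α′} {β′} {γ′} R R′ =
        B-off (suc i) (suc j) (i≢j ∘ suc-injective) bᵢⱼ≈0
        where
        p = B 1F (suc i)
        q′ = B 2F (suc i)
        r = B 1F (suc j)
        s = B 2F (suc j)
        bᵢⱼ = B (suc i) (suc j)

        -- Rows 1 and 2 give `b (γ - β) = q′ - p` for `i` and `b (γ′ - β′) = s - r` for `j`; the
        -- hypothesis equates the right-hand sides.
        cross : γ + β′ ≈ γ′ + β
        cross = *-cancelˡ-≉0 b≉0 (+-cancelʳ (p + s) _ _
          (x+0≈y+0⇒x≈y (0+0≈0 (relation₁ R′) (relation₂ R)) (0+0≈0 (relation₁ R) (relation₂ R′))
            (trans
              (solve 11 (λ a a′ β β′ γ γ′ b p q r s →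
                  b :* (γ :+ β′) :+ (p :+ s) :+ ((a′ :+ (con 0 :+ (γ′ :* b :+ r))) :+ (a :+ (β :* b :+ (con 0 :+ q))))
                  := (b :* (γ′ :+ β) :+ (r :+ q)) :+ ((a :+ (con 0 :+ (γ :* b :+ p))) :+ (a′ :+ (β′ :* b :+ (con 0 :+ s)))))
                ≈-refl α α′ β β′ γ γ′ b p q′ r s)
              (+-congʳ (+-congˡ (sym eq))))))

        sum≈ : β + γ ≈ β′ + γ′
        sum≈ = +-cancelʳ 1# _ _ (x+0≈y+0⇒x≈y (relation₀ R′) (relation₀ R)
          (solve 5 (λ β γ β′ γ′ o → β :+ γ :+ o :+ (con 0 :+ (β′ :+ (γ′ :+ o)))
                       := β′ :+ γ′ :+ o :+ (con 0 :+ (β :+ (γ :+ o)))) ≈-refl β γ β′ γ′ 1#))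

        -- Equal sums and equal differences give `2β = 2β′`.
        β≈β′ : β ≈ β′
        β≈β′ = *-cancelˡ-≉0 1+1≉0 (trans (sym (x+x≈[1+1]x β)) (trans
          (+-cancelʳ (γ + γ′) _ _ (trans
            (solve 3 (λ β γ γ′ → β :+ β :+ (γ :+ γ′) := (β :+ γ) :+ (γ′ :+ β)) ≈-refl β γ γ′)
            (trans (+-cong sum≈ (sym cross))
              (solve 3 (λ β′ γ γ′ → (β′ :+ γ′) :+ (γ :+ β′) := β′ :+ β′ :+ (γ :+ γ′))
                 ≈-refl β′ γ γ′))))
          (x+x≈[1+1]x β′)))

        γ≈γ′ : γ ≈ γ′
        γ≈γ′ = +-cancelˡ β _ _ (trans sum≈ (+-congʳ (sym β≈β′)))

        shift : ∀ u → α + B (suc u) (suc i) ≈ α′ + B (suc u) (suc j)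
        shift u = x+0≈y+0⇒x≈y
          (relationₛ R′ u)
          (trans (+-congˡ (+-cong (*-congʳ (sym β≈β′)) (+-congʳ (*-congʳ (sym γ≈γ′)))))
            (relationₛ R u))
          (solve 6 (λ a a′ t t′ y z →
              a :+ y :+ (a′ :+ (t :+ (t′ :+ z))) := a′ :+ z :+ (a :+ (t :+ (t′ :+ y))))
            ≈-refl α α′ (β′ * B (suc u) 1F) (γ′ * B (suc u) 2F) (B (suc u) (suc i)) (B (suc u) (suc j)))

        bᵢⱼ≈0 : bᵢⱼ ≈ 0#
        bᵢⱼ≈0 = x+x≈0⇒x≈0 (x+y≈y⇒x≈0 _ α (trans
          (solve 2 (λ a t → t :+ t :+ a := a :+ t :+ t) ≈-refl α bᵢⱼ)
          (trans (+-congʳ (trans (+-congˡ (B-sym _ _)) (trans (shift j) (trans (+-congˡ (B-diag _)) (+-identityʳ α′)))))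
            (trans (sym (shift i)) (trans (+-congˡ (B-diag _)) (+-identityʳ α))))))

    size≤ : suc (suc m) ≤ q
    size≤ = ≮⇒≥ size≰
      where
      size≰ : q < suc (suc m) → ⊥
      size≰ q<n with _≈?_ 𝔽 (1# + 1#) 0#
      ... | yes 1+1≈0 =
        let i , j , i≢j , eq = collision q<n (λ i → B 1F (suc i))
        in row₁-distinct 1+1≈0 i j i≢j eq
      ... | no 1+1≉0 =
        let i , j , i≢j , eq = collision q<n (λ i → B 1F (suc i) - B 2F (suc i))
        in relation i λ α β γ R → relation j λ α′ β′ γ′ R′ →
             relations-disagree i j i≢j (cross eq) R R′
        where
        open OddCharacteristic 1+1≉0
        open import Relation.Binary.Reasoning.Setoid setoid

        cross : ∀ {w x y z} → w - x ≈ y - z → w + z ≈ y + x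
        cross {w} {x} {y} {z} eq = begin
          w + z             ≈⟨ +-identityʳ _ ⟨
          w + z + 0#        ≈⟨ +-congˡ (-‿inverseʳ x) ⟨
          w + z + (x - x)   ≈⟨ solve 4 (λ w z x x⁻ → w :+ z :+ (x :+ x⁻) := (w :+ x⁻) :+ (z :+ x)) ≈-refl w z x (- x) ⟩
          (w - x) + (z + x) ≈⟨ +-congʳ eq ⟩
          (y - z) + (z + x) ≈⟨ solve 4 (λ y z⁻ z x → (y :+ z⁻) :+ (z :+ x) := y :+ x :+ (z :+ z⁻)) ≈-refl y (- z) z x ⟩
          y + x + (z - z)   ≈⟨ +-congˡ (-‿inverseʳ z) ⟩
          y + x + 0#        ≈⟨ +-identityʳ _ ⟩
          y + x             ∎

-- The points of a conic

module Conic {c ℓ q} (𝔽 : FiniteField c ℓ q) where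
  open FiniteField 𝔽 using () renaming (baseField to F)
  open Field F hiding (zero) renaming (refl to ≈-refl)
  open FieldProperties F
  open FiniteFieldProperties 𝔽 using (minRank≤; factorisation⇒rank≤)

  module _ {m} (t : Fin m → Carrier) (t-injective : ∀ i j → t i ≈ t j → i ≡ j) where

    -- `left` lists points of the conic `y² = x z`, with index `zero` at infinity, and `right` their
    -- images under the form `x z′ - 2 y y′ + z x′`. Keeping the two apart exhibits `gram` as a
    -- product through dimension 3 in every characteristic. `- t j` serves as an atom for the
    -- semiring solver.
    left right : Fin (suc m) → Fin 3 → Carrier
    left  zero    = 1# ∷ 0# ∷ 0# ∷ []
    left  (suc i) = t i * t i ∷ t i ∷ 1# ∷ []
    right zero    = 0# ∷ 0# ∷ 1# ∷ []
    right (suc j) = 1# ∷ - t j + - t j ∷ - t j * - t j ∷ []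

    gram : Fin (suc m) → Fin (suc m) → Carrier
    gram i j = sum (λ l → left i l * right j l)

    sum₃≈ : ∀ {a b c a′ b′ c′} → a ≈ a′ → b ≈ b′ → c ≈ c′ → a + (b + (c + 0#)) ≈ a′ + (b′ + c′)
    sum₃≈ a≈ b≈ c≈ = +-cong a≈ (+-cong b≈ (trans (+-identityʳ _) c≈))

    gram-00 : gram zero zero ≈ 0#
    gram-00 = trans (sum₃≈ (zeroʳ _) (zeroʳ _) (zeroˡ _)) (0+0≈0 ≈-refl (0+0≈0 ≈-refl ≈-refl))

    gram-0s : ∀ j → gram zero (suc j) ≈ 1#
    gram-0s j = trans (sum₃≈ (*-identityˡ 1#) (zeroˡ _) (zeroˡ _))
      (trans (+-congˡ (0+0≈0 ≈-refl ≈-refl)) (+-identityʳ 1#))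

    gram-s0 : ∀ i → gram (suc i) zero ≈ 1#
    gram-s0 i = trans (sum₃≈ (zeroʳ _) (zeroʳ _) (*-identityˡ 1#))
      (trans (+-identityˡ _) (+-identityˡ 1#))

    gram-ss : ∀ i j → gram (suc i) (suc j) ≈ (t i - t j) * (t i - t j)
    gram-ss i j = trans (sum₃≈ (*-identityʳ _) ≈-refl (*-identityˡ _))
      (solve 2 (λ x y → x :* x :+ (x :* (y :+ y) :+ y :* y) := (x :+ y) :* (x :+ y))
         ≈-refl (t i) (- t j))

    gram-sym : ∀ i j → gram i j ≈ gram j i
    gram-sym zero    zero    = ≈-refl
    gram-sym zero    (suc j) = trans (gram-0s j) (sym (gram-s0 j))
    gram-sym (suc i) zero    = trans (gram-s0 i) (sym (gram-0s i))
    gram-sym (suc i) (suc j) = begin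
      gram (suc i) (suc j)          ≈⟨ gram-ss i j ⟩
      (t i - t j) * (t i - t j)     ≈⟨ -x*-x≈x*x (t i - t j) ⟨
      - (t i - t j) * - (t i - t j) ≈⟨ *-cong flip flip ⟩
      (t j - t i) * (t j - t i)     ≈⟨ gram-ss j i ⟨
      gram (suc j) (suc i)          ∎
      where
      open import Relation.Binary.Reasoning.Setoid setoid
      flip : - (t i - t j) ≈ t j - t i
      flip = trans (sym (AbelianGroupProperties.⁻¹-∙-comm +-abelianGroup (t i) (- t j)))
        (trans (+-comm _ _) (+-congʳ (-‿involutive (t j))))

    gram-diag : ∀ i → gram i i ≈ 0#
    gram-diag zero    = gram-00
    gram-diag (suc i) = trans (gram-ss i i) (*-zeroʳ _ (-‿inverseʳ (t i)))

    gram-off : ∀ i j → i ≢ j → ¬ (gram i j ≈ 0#)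
    gram-off zero    zero    i≢j _  = i≢j refl
    gram-off zero    (suc j) _   eq = 1≉0 (trans (sym (gram-0s j)) eq)
    gram-off (suc i) zero    _   eq = 1≉0 (trans (sym (gram-s0 i)) eq)
    gram-off (suc i) (suc j) i≢j eq = tᵢ-tⱼ≉0 (*-zeroˡ⁻¹ tᵢ-tⱼ≉0 (trans (sym (gram-ss i j)) eq))
      where
      tᵢ-tⱼ≉0 : ¬ (t i - t j ≈ 0#)
      tᵢ-tⱼ≉0 = i≢j ∘ cong suc ∘ t-injective i j ∘ x-y≈0⇒x≈y (t i) (t j)

    -- All vertices of a class receive the same conic point, so the entries inside a class come from
    -- the zero diagonal of `gram`.
    minRank≤3 : (s : Fin (suc m) → ℕ) → ∀ {μ} → IsMinRank F (completeMultipartite s) μ → μ ≤ 3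
    minRank≤3 s μ-min = minRank≤ (completeMultipartite s) μ-min
      (record
        { symmetric = λ u v → gram-sym (proj₁ u) (proj₁ v)
        ; pattern-⇔ = λ u v _ → mk⇔
            (λ A≉0 → across (λ { refl → A≉0 (gram-diag (proj₁ u)) }))
            (λ { (across i≢j) → gram-off _ _ i≢j })
        })
      (λ k → factorisation⇒rank≤ (left ∘ proj₁) (right ∘ proj₁))

-- The two implications

module _ {c ℓ q} (𝔽 : FiniteField c ℓ q) where
  open FiniteFieldProperties 𝔽
  open Field F hiding (zero) renaming (refl to ≈-refl)
  open FieldProperties F

  -- Distinct field elements serve as the `m` parameters of the conic; the point at infinity
  -- accounts for the remaining class.
  q≥n-1⇒minRank≤3 : ∀ {m} (s : Fin (suc m) → ℕ) → ∀ {μ} →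
    IsMinRank F (completeMultipartite s) μ → m ≤ q → μ ≤ 3
  q≥n-1⇒minRank≤3 s μ-min m≤q = Conic.minRank≤3 𝔽 (λ i → El.from (inject≤ i m≤q))
    (λ i j → inject≤-injective m≤q m≤q i j ∘ from-injective) s μ-min

  -- The reduction to `IsotropicGram`: `A` attains the minimum rank, and `B` is a scaled principal
  -- submatrix of it with one isotropic vertex from each class.
  minRank≤3⇒q≥n-1 : ∀ {m} (s : Fin (suc (suc (suc m))) → ℕ) → (∀ i → 4 ≤ s i) → ∀ {μ} →
    IsMinRank F (completeMultipartite s) μ → μ ≤ 3 → suc (suc m) ≤ q
  minRank≤3⇒q≥n-1 {m} s 4≤s ((A , A∈𝒮 , _ , max) , _) μ≤3 =
    IsotropicGram.size≤ 𝔽 B B-sym B-diag B-off B-one B-dependent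
    where
    open 𝒮 A∈𝒮
    n = suc (suc (suc m))

    dependent : (col : Fin 4 → _) → ¬ IndependentColumns F A col
    dependent col ind with s≤s (s≤s (s≤s ())) ← ≤-trans (max 4 col ind) μ≤3

    member : ∀ i → Fin 4 → SimpleGraph.Vertex (completeMultipartite s)
    member i k = i , inject≤ k (4≤s i)

    A-within : ∀ i k l → k ≢ l → A (member i k) (member i l) ≈ 0#
    A-within i k l k≢l with _≈?_ 𝔽 (A (member i k) (member i l)) 0#
    ... | yes A≈0 = A≈0
    ... | no A≉0
      -- An independent set has no `within` edge, so a nonzero entry would be an `across` edge from
      -- a class to itself.
      with across i≢i ← Equivalence.to (pattern-⇔ (member i k) (member i l)
             (k≢l ∘ inject≤-injective (4≤s i) (4≤s i) k l
                  ∘ ,-injectiveʳ-UIP (Decidable⇒UIP.≡-irrelevant _≟_))) A≉0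
      = contradiction refl i≢i

    -- Four nonzero diagonal entries in one class would form a nonsingular diagonal 4 × 4 block,
    -- hence four independent columns.
    isotropic : ∀ i → ∃[ k ] A (member i k) (member i k) ≈ 0#
    isotropic i with any? (λ k → _≈?_ 𝔽 (A (member i k) (member i k)) 0#)
    ... | yes found = found
    ... | no none = contradiction
      (independent-diagonal A (member i) (λ k A≈0 → none (k , A≈0)) (A-within i))
      (dependent (member i))

    u : Fin n → SimpleGraph.Vertex (completeMultipartite s)
    u i = member i (proj₁ (isotropic i))

    A-off : ∀ i j → i ≢ j → ¬ (A (u i) (u j) ≈ 0#)
    A-off i j i≢j = Equivalence.from (pattern-⇔ (u i) (u j) (i≢j ∘ cong proj₁)) (across i≢j)

    -- With `d zero` equal to 1, the other `d i` invert row 0 of `A` on the chosen vertices, which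
    -- normalises row 0 of `B`. The inverses `e` are kept for `independent-scaled`.
    unit : ∀ i → ∃₂ λ d e → d * e ≈ 1#
    unit zero    = 1# , 1# , *-identityˡ 1#
    unit (suc i) =
      let a = A (u zero) (u (suc i))
          y , ay≈1 = inverse a (A-off zero (suc i) (λ ()))
      in y , a , trans (*-comm y a) ay≈1

    d e : Fin n → Carrier
    d i = proj₁ (unit i)
    e i = proj₁ (proj₂ (unit i))

    de≈1 : ∀ i → d i * e i ≈ 1#
    de≈1 i = proj₂ (proj₂ (unit i))

    B : Fin n → Fin n → Carrier
    B i j = d i * (d j * A (u i) (u j))

    B-sym : ∀ i j → B i j ≈ B j i
    B-sym i j = trans
      (solve 3 (λ x y a → x :* (y :* a) := y :* (x :* a)) ≈-refl (d i) (d j) (A (u i) (u j)))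
      (*-congˡ (*-congˡ (symmetric (u i) (u j))))

    B-diag : ∀ i → B i i ≈ 0#
    B-diag i = *-zeroʳ _ (*-zeroʳ _ (proj₂ (isotropic i)))

    B-off : ∀ i j → i ≢ j → ¬ (B i j ≈ 0#)
    B-off i j i≢j = A-off i j i≢j ∘ *-zeroˡ⁻¹ (unit⇒≉0 (de≈1 j)) ∘ *-zeroˡ⁻¹ (unit⇒≉0 (de≈1 i))

    B-one : ∀ i → B zero (suc i) ≈ 1#
    -- `e (suc i)` is by definition the entry `A (u zero) (u (suc i))`.
    B-one i = trans (*-identityˡ _) (de≈1 (suc i))

    B-dependent : (col : Fin 4 → Fin n) → ¬ IndependentColumns F B col
    B-dependent col = dependent (u ∘ col) ∘ independent-scaled A u d e de≈1 col

mainTheorem19 : ∀ (n : ℕ) → 1 ≤ n →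
    (s : Fin n → ℕ) → (∀ i → (n ∸ 1) ^ 2 < s i) →
    (q : ℕ) → IsPrimePower q →
    ∀ {c ℓ} (𝔽 : FiniteField c ℓ q) →
    mr 𝔽 (completeMultipartite s) ≤ 3 ⇔ q ≥ n ∸ 1
mainTheorem19 (suc m) _ s s> q _ 𝔽 =
  mk⇔ (forward m s s> μ-min) (q≥n-1⇒minRank≤3 𝔽 s μ-min)
  where
  μ-min = mr-isMinRank 𝔽 (completeMultipartite s)

  forward : ∀ m (s : Fin (suc m) → ℕ) → (∀ i → m ^ 2 < s i) → ∀ {μ} →
    IsMinRank (FiniteField.baseField 𝔽) (completeMultipartite s) μ → μ ≤ 3 → m ≤ q
  -- Here `m` is `n - 1`. For `n = 1` and `n = 2` the bound on `q` holds over any field;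
  -- `IsotropicGram` starts at three vertices.
  forward zero          s s> μ-min _   = z≤n
  forward (suc zero)    s s> μ-min _   = <⇒≤ (FiniteFieldProperties.1<q 𝔽)
  forward (suc (suc m)) s s> μ-min μ≤3 = minRank≤3⇒q≥n-1 𝔽 s
    -- `4 = 2 ^ 2 ≤ (n - 1) ^ 2 < s i` provides the four vertices in each class.
    (λ i → ≤-trans (^-monoˡ-≤ 2 {2} {suc (suc m)} (s≤s (s≤s z≤n))) (<⇒≤ (s> i))) μ-min μ≤3
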